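{- Let $\rho$ and $\tau$ be polymorphic types (types of System $\mathbf F$). If $\rho\trianglelefteq\tau$ then $FV(\rho)\subseteq FV(\tau)$.
   Context: Types of System $\mathbf F$ are built from type variables with $\to$ and $\forall$; $FV(\sigma)$ is the set of free type variables of $\sigma$. Terms are Church-style System $\mathbf F$ terms, with type abstraction $\Lambda a.M$ and type application $M\sigma$, and $=_{\beta\eta}$ is $\beta\eta$-equality (for both term and type abstraction/application). Retraction: $\rho\trianglelefteq\tau$ means that there are a type environment $E$ and terms $C$ (the coder), $D$ (the decoder) with $E,(x:\rho)\vdash C:\tau$, $E\vdash D:\tau\to\rho$, $x\notin FV(D)$, and $DC=_{\beta\eta}x$. The types of the free variables declared in $E$ are arbitrary. -}

module Defs where

open import Data.Fin using (Fin; zero; suc)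
open import Data.Nat using (ℕ; zero; suc)
open import Data.Vec using (Vec; _∷_; lookup; map)
open import Function using (_∘_)
open import Level using (0ℓ)
open import Relation.Binary using (Rel)
open import Relation.Binary.Construct.Closure.Equivalence using (EqClosure)
open import Relation.Unary using (Pred; _∪_; ｛_｝)

infixr 7 _⇒_
infixl 8 _·_ _∙_
infix  4 _⊢_∶_ _⟶_ _=βη_ _⊴_

-- Type variables are de Bruijn indices in ℕ, not in a bounded scope: an
-- environment may then mention type variables that occur in neither of the
-- types being compared.

data Ty : Set where
  tvar : ℕ → Ty
  _⇒_  : Ty → Ty → Ty
  ∀̇    : Ty → Ty

FV : Ty → Pred ℕ 0ℓ
FV (tvar a) = ｛ a ｝
FV (σ ⇒ τ)  = FV σ ∪ FV τ
FV (∀̇ σ)    = λ a → FV σ (suc a)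

liftᵀʳ : (ℕ → ℕ) → ℕ → ℕ
liftᵀʳ ξ zero    = zero
liftᵀʳ ξ (suc a) = suc (ξ a)

renᵀ : (ℕ → ℕ) → Ty → Ty
renᵀ ξ (tvar a) = tvar (ξ a)
renᵀ ξ (σ ⇒ τ)  = renᵀ ξ σ ⇒ renᵀ ξ τ
renᵀ ξ (∀̇ σ)    = ∀̇ (renᵀ (liftᵀʳ ξ) σ)

wkᵀ : Ty → Ty
wkᵀ = renᵀ suc

liftᵀ : (ℕ → Ty) → ℕ → Ty
liftᵀ s zero    = tvar zero
liftᵀ s (suc a) = wkᵀ (s a)

subᵀ : (ℕ → Ty) → Ty → Ty
subᵀ s (tvar a) = s a
subᵀ s (σ ⇒ τ)  = subᵀ s σ ⇒ subᵀ s τ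
subᵀ s (∀̇ σ)    = ∀̇ (subᵀ (liftᵀ s) σ)

singleᵀ : Ty → ℕ → Ty
singleᵀ τ zero    = τ
singleᵀ τ (suc a) = tvar a

_[_]ᵀ : Ty → Ty → Ty
σ [ τ ]ᵀ = subᵀ (singleᵀ τ) σ

-- M ∙ σ is application to a type.

data Tm (n : ℕ) : Set where
  var : Fin n → Tm n
  ƛ   : Ty → Tm (suc n) → Tm n
  _·_ : Tm n → Tm n → Tm n
  Λ   : Tm n → Tm n
  _∙_ : Tm n → Ty → Tm n

-- renᵗ and subᵗ act on the type variables of a term; ren and sub act on its
-- term variables.

renᵗ : ∀ {n} → (ℕ → ℕ) → Tm n → Tm n
renᵗ ξ (var i) = var i
renᵗ ξ (ƛ σ M) = ƛ (renᵀ ξ σ) (renᵗ ξ M)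
renᵗ ξ (M · N) = renᵗ ξ M · renᵗ ξ N
renᵗ ξ (Λ M)   = Λ (renᵗ (liftᵀʳ ξ) M)
renᵗ ξ (M ∙ σ) = renᵗ ξ M ∙ renᵀ ξ σ

subᵗ : ∀ {n} → (ℕ → Ty) → Tm n → Tm n
subᵗ s (var i) = var i
subᵗ s (ƛ σ M) = ƛ (subᵀ s σ) (subᵗ s M)
subᵗ s (M · N) = subᵗ s M · subᵗ s N
subᵗ s (Λ M)   = Λ (subᵗ (liftᵀ s) M)
subᵗ s (M ∙ σ) = subᵗ s M ∙ subᵀ s σ

_[_]ᵗ : ∀ {n} → Tm n → Ty → Tm n
M [ τ ]ᵗ = subᵗ (singleᵀ τ) M

liftʳ : ∀ {m n} → (Fin m → Fin n) → Fin (suc m) → Fin (suc n)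
liftʳ ξ zero    = zero
liftʳ ξ (suc i) = suc (ξ i)

ren : ∀ {m n} → (Fin m → Fin n) → Tm m → Tm n
ren ξ (var i) = var (ξ i)
ren ξ (ƛ σ M) = ƛ σ (ren (liftʳ ξ) M)
ren ξ (M · N) = ren ξ M · ren ξ N
ren ξ (Λ M)   = Λ (ren ξ M)
ren ξ (M ∙ σ) = ren ξ M ∙ σ

wk : ∀ {n} → Tm n → Tm (suc n)
wk = ren suc

lift : ∀ {m n} → (Fin m → Tm n) → Fin (suc m) → Tm (suc n)
lift s zero    = var zero
lift s (suc i) = wk (s i)

sub : ∀ {m n} → (Fin m → Tm n) → Tm m → Tm n
sub s (var i) = s i
sub s (ƛ σ M) = ƛ σ (sub (lift s) M)
sub s (M · N) = sub s M · sub s N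
sub s (Λ M)   = Λ (sub (renᵗ suc ∘ s) M)
sub s (M ∙ σ) = sub s M ∙ σ

single : ∀ {n} → Tm n → Fin (suc n) → Tm n
single N zero    = N
single N (suc i) = var i

_[_] : ∀ {n} → Tm (suc n) → Tm n → Tm n
M [ N ] = sub (single N) M

-- In ⊢Λ, weakening the environment replaces the side condition that the
-- abstracted type variable is not free in it.

data _⊢_∶_ {n : ℕ} (E : Vec Ty n) : Tm n → Ty → Set where
  ⊢var : ∀ i → E ⊢ var i ∶ lookup E i
  ⊢ƛ   : ∀ {σ τ M} → (σ ∷ E) ⊢ M ∶ τ → E ⊢ ƛ σ M ∶ σ ⇒ τ
  ⊢·   : ∀ {σ τ M N} → E ⊢ M ∶ σ ⇒ τ → E ⊢ N ∶ σ → E ⊢ M · N ∶ τ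
  ⊢Λ   : ∀ {σ M} → map wkᵀ E ⊢ M ∶ σ → E ⊢ Λ M ∶ ∀̇ σ
  ⊢∙   : ∀ {σ M} → E ⊢ M ∶ ∀̇ σ → ∀ τ → E ⊢ M ∙ τ ∶ σ [ τ ]ᵀ

-- In the η-rules, weakening M replaces the side condition that the abstracted
-- variable is not free in M.

data _⟶_ {n : ℕ} : Rel (Tm n) 0ℓ where
  β-ƛ : ∀ {σ M N} → ƛ σ M · N ⟶ M [ N ]
  β-Λ : ∀ {M τ} → Λ M ∙ τ ⟶ M [ τ ]ᵗ
  η-ƛ : ∀ {σ M} → ƛ σ (wk M · var zero) ⟶ M
  η-Λ : ∀ {M} → Λ (renᵗ suc M ∙ tvar zero) ⟶ M
  ξ-ƛ : ∀ {σ M M′} → M ⟶ M′ → ƛ σ M ⟶ ƛ σ M′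
  ξ-·ˡ : ∀ {M M′ N} → M ⟶ M′ → M · N ⟶ M′ · N
  ξ-·ʳ : ∀ {M N N′} → N ⟶ N′ → M · N ⟶ M · N′
  ξ-Λ : ∀ {M M′} → M ⟶ M′ → Λ M ⟶ Λ M′
  ξ-∙ : ∀ {M M′ τ} → M ⟶ M′ → M ∙ τ ⟶ M′ ∙ τ

-- Intermediate terms of a conversion need not be typable, so this contains
-- βη-equality of typed terms.

_=βη_ : ∀ {n} → Rel (Tm n) 0ℓ
_=βη_ = EqClosure _⟶_

-- The variable x : ρ is index zero over E, so that x is not free in the
-- decoder because the decoder lives over E alone.

record _⊴_ (ρ τ : Ty) : Set where
  field
    {size}    : ℕ
    E         : Vec Ty size
    C         : Tm (suc size)
    D         : Tm size
    C-typed   : (ρ ∷ E) ⊢ C ∶ τ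
    D-typed   : E ⊢ D ∶ τ ⇒ ρ
    retract   : wk D · C =βη var zero

{-# OPTIONS --safe #-}
module Submission where

-- Suppose a is free in ρ but not in τ. Rename a to a fresh a′ in the decoder and
-- in the types of its free variables y, which become y′. The renamed decoder still
-- accepts the coder, now with result type ρ[a′/a], and identifying a with a′ and y
-- with y′ turns this composite into D C. Reductions lift along that
-- identification, so if D C reduces to x then so does the typed composite; by
-- subject reduction x has both types ρ and ρ[a′/a], which is absurd.
--
-- Two things need care. Reduction is confluent only once annotations are erased,
-- and then the type η-rule loses subject reduction. So all β-steps are done first,
-- by postponement of η, and what remains is an η-expansion of x, whose innermost
-- η-redexes have abstraction-free bodies and can be contracted in a typed way.

open import Data.Empty using (⊥; ⊥-elim)
open import Data.Fin using (Fin; zero; suc; toℕ)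
open import Data.Nat using (ℕ; zero; suc; _≟_)
open import Data.Nat.Properties using (suc-injective)
open import Data.Product using (∃-syntax; _×_; _,_; proj₁; proj₂; map₂; swap)
open import Data.Sum using (_⊎_; inj₁; inj₂)
open import Data.Unit using (⊤; tt)
open import Data.Vec using (_∷_; lookup; map)
open import Data.Vec.Properties using (lookup-map)
open import Function using (_∘_; id)
open import Level using (0ℓ)
open import Relation.Binary using (Rel)
open import Relation.Binary.Construct.Closure.ReflexiveTransitive using (Star; ε; _◅_; _◅◅_; gmap)
open import Relation.Binary.Construct.Closure.Symmetric using (fwd; bwd)
open import Relation.Binary.PropositionalEquality
  using (_≡_; _≢_; refl; sym; trans; cong; cong₂; subst; module ≡-Reasoning)
open import Relation.Nullary using (Dec; yes; no)
open import Relation.Nullary.Decidable using (_⊎-dec_)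
open import Relation.Unary using (_⊆_)
open import Defs

open ≡-Reasoning

-- Type variables and term variables share one name space. The tag active marks
-- term constructors, which β and η may contract; types are built with rigid ones.
data Tag : Set where
  active rigid : Tag

data Raw : Set where
  var : ℕ → Raw
  lam : Tag → Raw → Raw
  app : Tag → Raw → Raw → Raw

-- Renaming and substitution of raw terms.

renᴿ : (ℕ → ℕ) → Raw → Raw
renᴿ ξ (var k)     = var (ξ k)
renᴿ ξ (lam t M)   = lam t (renᴿ (liftᵀʳ ξ) M)
renᴿ ξ (app t M N) = app t (renᴿ ξ M) (renᴿ ξ N)

wkᴿ : Raw → Raw
wkᴿ = renᴿ suc

liftᴿ : (ℕ → Raw) → ℕ → Raw
liftᴿ s zero    = var zero
liftᴿ s (suc k) = wkᴿ (s k)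

subᴿ : (ℕ → Raw) → Raw → Raw
subᴿ s (var k)     = s k
subᴿ s (lam t M)   = lam t (subᴿ (liftᴿ s) M)
subᴿ s (app t M N) = app t (subᴿ s M) (subᴿ s N)

singleᴿ : Raw → ℕ → Raw
singleᴿ N zero    = N
singleᴿ N (suc k) = var k

_[_]ᴿ : Raw → Raw → Raw
M [ N ]ᴿ = subᴿ (singleᴿ N) M

renᴿ-renᴿ : ∀ {ξ ζ χ} → (∀ k → ζ (ξ k) ≡ χ k) → ∀ M → renᴿ ζ (renᴿ ξ M) ≡ renᴿ χ M
renᴿ-renᴿ h (var k)     = cong var (h k)
renᴿ-renᴿ h (lam t M)   = cong (lam t) (renᴿ-renᴿ (λ { zero → refl ; (suc k) → cong suc (h k) }) M)
renᴿ-renᴿ h (app t M N) = cong₂ (app t) (renᴿ-renᴿ h M) (renᴿ-renᴿ h N)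

subᴿ-var : ∀ {ξ s} → (∀ k → s k ≡ var (ξ k)) → ∀ M → subᴿ s M ≡ renᴿ ξ M
subᴿ-var h (var k)     = h k
subᴿ-var h (lam t M)   = cong (lam t) (subᴿ-var (λ { zero → refl ; (suc k) → cong wkᴿ (h k) }) M)
subᴿ-var h (app t M N) = cong₂ (app t) (subᴿ-var h M) (subᴿ-var h N)

renᴿ-id : ∀ {ξ} → (∀ k → ξ k ≡ k) → ∀ M → renᴿ ξ M ≡ M
renᴿ-id h (var k)     = cong var (h k)
renᴿ-id h (lam t M)   = cong (lam t) (renᴿ-id (λ { zero → refl ; (suc k) → cong suc (h k) }) M)
renᴿ-id h (app t M N) = cong₂ (app t) (renᴿ-id h M) (renᴿ-id h N)

subᴿ-id : ∀ {s} → (∀ k → s k ≡ var k) → ∀ M → subᴿ s M ≡ M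
subᴿ-id h M = trans (subᴿ-var h M) (renᴿ-id (λ _ → refl) M)

subᴿ-renᴿ : ∀ {ξ s u} → (∀ k → s (ξ k) ≡ u k) → ∀ M → subᴿ s (renᴿ ξ M) ≡ subᴿ u M
subᴿ-renᴿ h (var k)     = h k
subᴿ-renᴿ h (lam t M)   = cong (lam t) (subᴿ-renᴿ (λ { zero → refl ; (suc k) → cong wkᴿ (h k) }) M)
subᴿ-renᴿ h (app t M N) = cong₂ (app t) (subᴿ-renᴿ h M) (subᴿ-renᴿ h N)

renᴿ-wkᴿ : ∀ ξ M → renᴿ (liftᵀʳ ξ) (wkᴿ M) ≡ wkᴿ (renᴿ ξ M)
renᴿ-wkᴿ ξ M = trans (renᴿ-renᴿ (λ _ → refl) M) (sym (renᴿ-renᴿ (λ _ → refl) M))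

renᴿ-subᴿ : ∀ {ξ s u} → (∀ k → renᴿ ξ (s k) ≡ u k) → ∀ M → renᴿ ξ (subᴿ s M) ≡ subᴿ u M
renᴿ-subᴿ h (var k) = h k
renᴿ-subᴿ {ξ} {s} h (lam t M) = cong (lam t)
  (renᴿ-subᴿ (λ { zero → refl ; (suc k) → trans (renᴿ-wkᴿ ξ (s k)) (cong wkᴿ (h k)) }) M)
renᴿ-subᴿ h (app t M N) = cong₂ (app t) (renᴿ-subᴿ h M) (renᴿ-subᴿ h N)

subᴿ-wkᴿ : ∀ s M → subᴿ (liftᴿ s) (wkᴿ M) ≡ wkᴿ (subᴿ s M)
subᴿ-wkᴿ s M = trans (subᴿ-renᴿ (λ _ → refl) M) (sym (renᴿ-subᴿ (λ _ → refl) M))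

subᴿ-subᴿ : ∀ {s u v} → (∀ k → subᴿ u (s k) ≡ v k) → ∀ M → subᴿ u (subᴿ s M) ≡ subᴿ v M
subᴿ-subᴿ h (var k) = h k
subᴿ-subᴿ {s} {u} h (lam t M) = cong (lam t)
  (subᴿ-subᴿ (λ { zero → refl ; (suc k) → trans (subᴿ-wkᴿ u (s k)) (cong wkᴿ (h k)) }) M)
subᴿ-subᴿ h (app t M N) = cong₂ (app t) (subᴿ-subᴿ h M) (subᴿ-subᴿ h N)

wkᴿ-[] : ∀ M {N} → wkᴿ M [ N ]ᴿ ≡ M
wkᴿ-[] M = trans (subᴿ-renᴿ (λ _ → refl) M) (subᴿ-id (λ _ → refl) M)

renᴿ-[] : ∀ ξ M N → renᴿ ξ (M [ N ]ᴿ) ≡ renᴿ (liftᵀʳ ξ) M [ renᴿ ξ N ]ᴿ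
renᴿ-[] ξ M N = trans (renᴿ-subᴿ (λ _ → refl) M)
  (sym (subᴿ-renᴿ (λ { zero → refl ; (suc _) → refl }) M))

subᴿ-[] : ∀ s M N → subᴿ s (M [ N ]ᴿ) ≡ subᴿ (liftᴿ s) M [ subᴿ s N ]ᴿ
subᴿ-[] s M N = trans (subᴿ-subᴿ (λ _ → refl) M)
  (sym (subᴿ-subᴿ (λ { zero → refl ; (suc k) → wkᴿ-[] (s k) }) M))

lift-suc-[0] : ∀ M → renᴿ (liftᵀʳ suc) M [ var 0 ]ᴿ ≡ M
lift-suc-[0] M = trans (subᴿ-renᴿ (λ _ → refl) M) (subᴿ-id (λ { zero → refl ; (suc _) → refl }) M)

Injective : (ℕ → ℕ) → Set
Injective ξ = ∀ {k l} → ξ k ≡ ξ l → k ≡ l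

liftᵀʳ-injective : ∀ {ξ} → Injective ξ → Injective (liftᵀʳ ξ)
liftᵀʳ-injective i {zero}  {zero}  _ = refl
liftᵀʳ-injective i {suc _} {suc _} e = cong suc (i (suc-injective e))

var-injective : ∀ {k l} → Raw.var k ≡ var l → k ≡ l
var-injective refl = refl

lam-injective : ∀ {t u M N} → lam t M ≡ lam u N → t ≡ u × M ≡ N
lam-injective refl = refl , refl

app-injective : ∀ {t u M N M′ N′} → app t M N ≡ app u M′ N′ → t ≡ u × M ≡ M′ × N ≡ N′
app-injective refl = refl , refl , refl

renᴿ-injective : ∀ {ξ} → Injective ξ → ∀ M N → renᴿ ξ M ≡ renᴿ ξ N → M ≡ N
renᴿ-injective i (var k) (var l) e = cong var (i (var-injective e))
renᴿ-injective i (lam t M) (lam u N) e with lam-injective e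
... | refl , e′ = cong (lam t) (renᴿ-injective (liftᵀʳ-injective i) M N e′)
renᴿ-injective i (app t M M′) (app u N N′) e with app-injective e
... | refl , e₁ , e₂ = cong₂ (app t) (renᴿ-injective i M N e₁) (renᴿ-injective i M′ N′ e₂)

infix 4 _⇛_ _⇛*_ _⊒_ _⊒*_ _↓_

-- Parallel β-reduction

data _⇛_ : Rel Raw 0ℓ where
  var  : ∀ {k} → var k ⇛ var k
  lam  : ∀ {t M M′} → M ⇛ M′ → lam t M ⇛ lam t M′
  app  : ∀ {t M M′ N N′} → M ⇛ M′ → N ⇛ N′ → app t M N ⇛ app t M′ N′
  beta : ∀ {M M′ N N′} → M ⇛ M′ → N ⇛ N′ → app active (lam active M) N ⇛ M′ [ N′ ]ᴿ

_⇛*_ : Rel Raw 0ℓ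
_⇛*_ = Star _⇛_

⇛-refl : ∀ M → M ⇛ M
⇛-refl (var k)     = var
⇛-refl (lam t M)   = lam (⇛-refl M)
⇛-refl (app t M N) = app (⇛-refl M) (⇛-refl N)

⇛-beta : ∀ {P} M N → M [ N ]ᴿ ≡ P → app active (lam active M) N ⇛ P
⇛-beta M N refl = beta (⇛-refl M) (⇛-refl N)

⇛-ren : ∀ ξ {M M′} → M ⇛ M′ → renᴿ ξ M ⇛ renᴿ ξ M′
⇛-ren ξ var       = var
⇛-ren ξ (lam r)   = lam (⇛-ren (liftᵀʳ ξ) r)
⇛-ren ξ (app r q) = app (⇛-ren ξ r) (⇛-ren ξ q)
⇛-ren ξ (beta {M′ = M′} {N′ = N′} r q) =
  subst (_ ⇛_) (sym (renᴿ-[] ξ M′ N′)) (beta (⇛-ren (liftᵀʳ ξ) r) (⇛-ren ξ q))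

⇛-sub : ∀ {s u M M′} → (∀ k → s k ⇛ u k) → M ⇛ M′ → subᴿ s M ⇛ subᴿ u M′
⇛-lift : ∀ {s u} → (∀ k → s k ⇛ u k) → ∀ k → liftᴿ s k ⇛ liftᴿ u k

⇛-lift h zero    = var
⇛-lift h (suc k) = ⇛-ren suc (h k)

⇛-sub h (var {k}) = h k
⇛-sub h (lam r)   = lam (⇛-sub (⇛-lift h) r)
⇛-sub h (app r q) = app (⇛-sub h r) (⇛-sub h q)
⇛-sub {u = u} h (beta {M′ = M′} {N′ = N′} r q) =
  subst (_ ⇛_) (sym (subᴿ-[] u M′ N′)) (beta (⇛-sub (⇛-lift h) r) (⇛-sub h q))

⇛-[] : ∀ {M M′ N N′} → M ⇛ M′ → N ⇛ N′ → M [ N ]ᴿ ⇛ M′ [ N′ ]ᴿ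
⇛-[] r q = ⇛-sub (λ { zero → q ; (suc _) → var }) r

-- β introduces no free variables, so it stays in the image of a renaming; this moves steps out of
-- the weakened body of an η-redex. The source enters through an equation so that a step can be
-- matched without unifying its index with `renᴿ ξ M`.
⇛-ren⁻¹ : ∀ ξ {K N} → K ⇛ N → ∀ M → K ≡ renᴿ ξ M → ∃[ M′ ] N ≡ renᴿ ξ M′ × M ⇛ M′
⇛-ren⁻¹ ξ var (var k) refl = var k , refl , var
⇛-ren⁻¹ ξ (lam r) (lam t M) refl with ⇛-ren⁻¹ (liftᵀʳ ξ) r M refl
... | M′ , refl , r′ = lam t M′ , refl , lam r′
⇛-ren⁻¹ ξ (app r q) (app t M N) refl with ⇛-ren⁻¹ ξ r M refl | ⇛-ren⁻¹ ξ q N refl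
... | M′ , refl , r′ | N′ , refl , q′ = app t M′ N′ , refl , app r′ q′
⇛-ren⁻¹ ξ (beta r q) (app active (lam active M) N) refl
  with ⇛-ren⁻¹ (liftᵀʳ ξ) r M refl | ⇛-ren⁻¹ ξ q N refl
... | M′ , refl , r′ | N′ , refl , q′ = M′ [ N′ ]ᴿ , sym (renᴿ-[] ξ M′ N′) , beta r′ q′

⇛-diamond : ∀ {M N P} → M ⇛ N → M ⇛ P → ∃[ Q ] N ⇛ Q × P ⇛ Q
⇛-diamond var var = _ , var , var
⇛-diamond (lam r) (lam q) with ⇛-diamond r q
... | _ , r′ , q′ = _ , lam r′ , lam q′
⇛-diamond (app r₁ r₂) (app q₁ q₂) with ⇛-diamond r₁ q₁ | ⇛-diamond r₂ q₂
... | _ , r₁′ , q₁′ | _ , r₂′ , q₂′ = _ , app r₁′ r₂′ , app q₁′ q₂′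
⇛-diamond (app (lam r₁) r₂) (beta q₁ q₂) with ⇛-diamond r₁ q₁ | ⇛-diamond r₂ q₂
... | _ , r₁′ , q₁′ | _ , r₂′ , q₂′ = _ , beta r₁′ r₂′ , ⇛-[] q₁′ q₂′
⇛-diamond (beta r₁ r₂) (app (lam q₁) q₂) with ⇛-diamond r₁ q₁ | ⇛-diamond r₂ q₂
... | _ , r₁′ , q₁′ | _ , r₂′ , q₂′ = _ , ⇛-[] r₁′ r₂′ , beta q₁′ q₂′
⇛-diamond (beta r₁ r₂) (beta q₁ q₂) with ⇛-diamond r₁ q₁ | ⇛-diamond r₂ q₂
... | _ , r₁′ , q₁′ | _ , r₂′ , q₂′ = _ , ⇛-[] r₁′ r₂′ , ⇛-[] q₁′ q₂′

-- Parallel η-reduction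

data _⊒_ : Rel Raw 0ℓ where
  var : ∀ {k} → var k ⊒ var k
  lam : ∀ {t M M′} → M ⊒ M′ → lam t M ⊒ lam t M′
  app : ∀ {t M M′ N N′} → M ⊒ M′ → N ⊒ N′ → app t M N ⊒ app t M′ N′
  eta : ∀ {K M M′} → K ≡ wkᴿ M → M ⊒ M′ → lam active (app active K (var 0)) ⊒ M′

_⊒*_ : Rel Raw 0ℓ
_⊒*_ = Star _⊒_

⊒-refl : ∀ M → M ⊒ M
⊒-refl (var k)     = var
⊒-refl (lam t M)   = lam (⊒-refl M)
⊒-refl (app t M N) = app (⊒-refl M) (⊒-refl N)

⊒-ren : ∀ ξ {M M′} → M ⊒ M′ → renᴿ ξ M ⊒ renᴿ ξ M′
⊒-ren ξ var       = var
⊒-ren ξ (lam r)   = lam (⊒-ren (liftᵀʳ ξ) r)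
⊒-ren ξ (app r q) = app (⊒-ren ξ r) (⊒-ren ξ q)
⊒-ren ξ (eta {M = M} refl r) = eta (renᴿ-wkᴿ ξ M) (⊒-ren ξ r)

⊒-sub : ∀ {s u M M′} → (∀ k → s k ⊒ u k) → M ⊒ M′ → subᴿ s M ⊒ subᴿ u M′
⊒-sub h (var {k}) = h k
⊒-sub h (lam r)   = lam (⊒-sub (λ { zero → var ; (suc k) → ⊒-ren suc (h k) }) r)
⊒-sub h (app r q) = app (⊒-sub h r) (⊒-sub h q)
⊒-sub {s} h (eta {M = M} refl r) = eta (subᴿ-wkᴿ s M) (⊒-sub h r)

⊒-[] : ∀ {M M′ N N′} → M ⊒ M′ → N ⊒ N′ → M [ N ]ᴿ ⊒ M′ [ N′ ]ᴿ
⊒-[] r q = ⊒-sub (λ { zero → q ; (suc _) → var }) r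

-- The existence half of a pullback square of renamings. It gives strengthening: a term in the
-- images of both `ξ` and `ζ` comes from a single term. `lift-suc-pullback` supplies it for every
-- `ξ`, including one that identifies names.
Pullback : (ξ ζ ξ′ ζ′ : ℕ → ℕ) → Set
Pullback ξ ζ ξ′ ζ′ = ∀ k l → ξ k ≡ ζ l → ∃[ m ] k ≡ ξ′ m × l ≡ ζ′ m

liftᵀʳ-pullback : ∀ {ξ ζ ξ′ ζ′} → Pullback ξ ζ ξ′ ζ′ →
  Pullback (liftᵀʳ ξ) (liftᵀʳ ζ) (liftᵀʳ ξ′) (liftᵀʳ ζ′)
liftᵀʳ-pullback p zero    zero    _ = zero , refl , refl
liftᵀʳ-pullback p (suc k) (suc l) e with p k l (suc-injective e)
... | m , e₁ , e₂ = suc m , cong suc e₁ , cong suc e₂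

renᴿ-pullback : ∀ {ξ ζ ξ′ ζ′} → Pullback ξ ζ ξ′ ζ′ → ∀ M N → renᴿ ξ M ≡ renᴿ ζ N →
  ∃[ P ] M ≡ renᴿ ξ′ P × N ≡ renᴿ ζ′ P
renᴿ-pullback p (var k) (var l) e with p k l (var-injective e)
... | m , e₁ , e₂ = var m , cong var e₁ , cong var e₂
renᴿ-pullback p (lam t M) (lam u N) e with lam-injective e
... | refl , e′ with renᴿ-pullback (liftᵀʳ-pullback p) M N e′
... | P , e₁ , e₂ = lam t P , cong (lam t) e₁ , cong (lam t) e₂
renᴿ-pullback p (app t M M′) (app u N N′) e with app-injective e
... | refl , e₁ , e₂ with renᴿ-pullback p M N e₁ | renᴿ-pullback p M′ N′ e₂
... | P , d₁ , d₂ | P′ , d₁′ , d₂′ = app t P P′ , cong₂ (app t) d₁ d₁′ , cong₂ (app t) d₂ d₂′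

lift-suc-pullback : ∀ ξ → Pullback (liftᵀʳ ξ) suc suc ξ
lift-suc-pullback ξ (suc k) l e = k , refl , sym (suc-injective e)

⊒-ren⁻¹ : ∀ ξ {K N} → K ⊒ N → ∀ M → K ≡ renᴿ ξ M → ∃[ M′ ] N ≡ renᴿ ξ M′ × M ⊒ M′
⊒-ren⁻¹ ξ var (var k) refl = var k , refl , var
⊒-ren⁻¹ ξ (lam r) (lam t M) refl with ⊒-ren⁻¹ (liftᵀʳ ξ) r M refl
... | M′ , refl , r′ = lam t M′ , refl , lam r′
⊒-ren⁻¹ ξ (app r q) (app t M N) refl with ⊒-ren⁻¹ ξ r M refl | ⊒-ren⁻¹ ξ q N refl
... | M′ , refl , r′ | N′ , refl , q′ = app t M′ N′ , refl , app r′ q′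
⊒-ren⁻¹ ξ (eta {M = P} e r) (lam active (app active K (var zero))) refl
  with renᴿ-pullback (lift-suc-pullback ξ) K P e
... | Q , refl , e′ with ⊒-ren⁻¹ ξ r Q e′
... | M′ , refl , r′ = M′ , refl , eta refl r′

-- The strengthened body `M` of an η-redex is not a subterm of it, but a renaming of `M` is the
-- subterm `T` of the renamed source. This supplies the smaller argument for the recursion in
-- `⊒-diamond′`.
eta-source : ∀ {t u v w T U K L ξ} M → lam t (app u T U) ≡ renᴿ ξ (lam v (app w K L)) →
  K ≡ wkᴿ M → T ≡ renᴿ (suc ∘ ξ) M
eta-source M refl refl = renᴿ-renᴿ (λ _ → refl) M

-- The recursion is on T, a renaming of the source, because eta strengthens its body.
⊒-diamond′ : ∀ T ξ {M N P} → T ≡ renᴿ ξ M → M ⊒ N → M ⊒ P → ∃[ Q ] N ⊒ Q × P ⊒ Q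
⊒-diamond′ T ξ _ var var = _ , var , var
⊒-diamond′ (lam t T) ξ e (lam r) (lam q) with ⊒-diamond′ T (liftᵀʳ ξ) (proj₂ (lam-injective e)) r q
... | _ , r′ , q′ = _ , lam r′ , lam q′
⊒-diamond′ (lam _ (app _ T _)) ξ e (lam (app r var)) (eta {M = M} d q)
  with ⊒-ren⁻¹ suc r M d
... | _ , d′ , r′ with ⊒-diamond′ T (suc ∘ ξ) (eta-source M e d) r′ q
... | _ , r″ , q′ = _ , eta d′ r″ , q′
⊒-diamond′ (app t T U) ξ e (app r₁ r₂) (app q₁ q₂)
  with ⊒-diamond′ T ξ (proj₁ (proj₂ (app-injective e))) r₁ q₁
     | ⊒-diamond′ U ξ (proj₂ (proj₂ (app-injective e))) r₂ q₂
... | _ , r₁′ , q₁′ | _ , r₂′ , q₂′ = _ , app r₁′ r₂′ , app q₁′ q₂′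
⊒-diamond′ (lam _ (app _ T _)) ξ e (eta {M = M} d r) (lam (app q var))
  with ⊒-ren⁻¹ suc q M d
... | _ , d′ , q′ with ⊒-diamond′ T (suc ∘ ξ) (eta-source M e d) r q′
... | _ , r′ , q″ = _ , r′ , eta d′ q″
⊒-diamond′ (lam _ (app _ T _)) ξ e (eta {M = M} d r) (eta {M = N} d′ q)
  with renᴿ-injective suc-injective M N (trans (sym d) d′)
... | refl = ⊒-diamond′ T (suc ∘ ξ) (eta-source M e d) r q

⊒-diamond : ∀ {M N P} → M ⊒ N → M ⊒ P → ∃[ Q ] N ⊒ Q × P ⊒ Q
⊒-diamond {M} = ⊒-diamond′ (renᴿ id M) id refl

-- Commutation of η with β, and postponement of η.

wkᴿ-body : ∀ {t A} M → lam t A ≡ wkᴿ M → ∃[ B ] M ≡ lam t B × A ≡ renᴿ (liftᵀʳ suc) B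
wkᴿ-body (lam t B) refl = B , refl , refl

η-commutes-β : ∀ {M N P} → M ⊒ N → M ⇛ P → ∃[ Q ] N ⇛ Q × P ⊒ Q
-- The abstraction of a β-redex may itself be an η-redex, possibly a nest of them. If its body is
-- not contracted at the head, β on the outside has the same effect as η; if it is, `M` is again an
-- abstraction and the argument repeats one layer further in.
η-commutes-redex : ∀ {A A′ B B′ F C} → lam active A ⊒ F → A ⇛ A′ → B ⊒ C → B ⇛ B′ →
  ∃[ Q ] app active F C ⇛ Q × A′ [ B′ ]ᴿ ⊒ Q

η-commutes-β var var = _ , var , var
η-commutes-β (lam r) (lam q) with η-commutes-β r q
... | _ , q′ , r′ = _ , lam q′ , lam r′
η-commutes-β (app r₁ r₂) (app q₁ q₂) with η-commutes-β r₁ q₁ | η-commutes-β r₂ q₂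
... | _ , q₁′ , r₁′ | _ , q₂′ , r₂′ = _ , app q₁′ q₂′ , app r₁′ r₂′
η-commutes-β (app r₁ r₂) (beta q₁ q₂) = η-commutes-redex r₁ q₁ r₂ q₂
η-commutes-β (eta {M = M} e r) (lam (app q var)) with ⇛-ren⁻¹ suc q M e
... | _ , e′ , q′ with η-commutes-β r q′
... | _ , q″ , r′ = _ , q″ , eta e′ r′
-- The critical overlap: `M` is an abstraction, and applying its weakening to `var 0` under a binder
-- gives `M` back, up to steps inside its body.
η-commutes-β (eta {M = M} e r) (lam (beta {M′ = A′} q var)) with wkᴿ-body M e
... | B , refl , e′ with ⇛-ren⁻¹ (liftᵀʳ suc) q B e′
... | B′ , refl , q′ with η-commutes-β r (lam q′)
... | Q , q″ , r′ = Q , q″ , subst (λ X → lam _ X ⊒ Q) (sym (lift-suc-[0] B′)) r′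

η-commutes-redex (lam r) q r₂ q₂ with η-commutes-β r q | η-commutes-β r₂ q₂
... | _ , q′ , r′ | _ , q₂′ , r₂′ = _ , beta q′ q₂′ , ⊒-[] r′ r₂′
η-commutes-redex (eta {M = M} e r) (app q var) r₂ q₂ with ⇛-ren⁻¹ suc q M e
... | M′ , refl , q′ with η-commutes-β r q′ | η-commutes-β r₂ q₂
... | _ , q″ , r′ | _ , q₂′ , r₂′ =
  _ , app q″ q₂′ , app (subst (_⊒ _) (sym (wkᴿ-[] M′)) r′) r₂′
η-commutes-redex {B′ = B′} (eta {M = M} e r) (beta q var) r₂ q₂ with wkᴿ-body M e
... | A , refl , e′ with ⇛-ren⁻¹ (liftᵀʳ suc) q A e′
... | A′ , refl , q′ with η-commutes-redex r q′ r₂ q₂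
... | Q , q″ , r′ = Q , q″ , subst (λ X → X [ B′ ]ᴿ ⊒ Q) (sym (lift-suc-[0] A′)) r′

⇛*-lam : ∀ {t M N} → M ⇛* N → lam t M ⇛* lam t N
⇛*-lam = gmap (lam _) lam

⇛*-app : ∀ {t M M′ N N′} → M ⇛* M′ → N ⇛* N′ → app t M N ⇛* app t M′ N′
⇛*-app {t} {M′ = M′} {N} rs qs =
  gmap (λ X → app t X N) (λ r → app r (⇛-refl N)) rs ◅◅ gmap (app t M′) (app (⇛-refl M′)) qs

-- One step may become several: if η has uncovered the abstraction of a β-redex, each η-expansion
-- around it costs one extra β-step before the redex is reached. `η-postponement-redex` peels these
-- layers off, with a body `B` independent of the argument, which reduces separately.
η-postponement : ∀ {M N P} → M ⊒ N → N ⇛ P → ∃[ Q ] M ⇛* Q × Q ⊒ P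
η-postponement-redex : ∀ {F A A′} → F ⊒ lam active A → A ⇛ A′ →
  ∃[ B ] (∀ N → app active F N ⇛* B [ N ]ᴿ) × B ⊒ A′

η-postponement var var = _ , ε , var
η-postponement (lam r) (lam q) with η-postponement r q
... | _ , qs , r′ = _ , ⇛*-lam qs , lam r′
η-postponement (app r₁ r₂) (app q₁ q₂) with η-postponement r₁ q₁ | η-postponement r₂ q₂
... | _ , qs₁ , r₁′ | _ , qs₂ , r₂′ = _ , ⇛*-app qs₁ qs₂ , app r₁′ r₂′
η-postponement (app r₁ r₂) (beta q₁ q₂) with η-postponement-redex r₁ q₁ | η-postponement r₂ q₂
... | _ , qs₁ , r₁′ | N , qs₂ , r₂′ = _ , ⇛*-app ε qs₂ ◅◅ qs₁ N , ⊒-[] r₁′ r₂′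
η-postponement (eta refl r) q with η-postponement r q
... | _ , qs , r′ = _ , ⇛*-lam (⇛*-app (gmap wkᴿ (⇛-ren suc) qs) ε) , eta refl r′

η-postponement-redex (lam r) q with η-postponement r q
... | B , qs , r′ = B , (λ N → ⇛*-app (⇛*-lam qs) ε ◅◅ beta (⇛-refl B) (⇛-refl N) ◅ ε) , r′
η-postponement-redex (eta {M = M} refl r) q with η-postponement-redex r q
... | B , qs , r′ = B , (λ N → contract N ◅ qs N) , r′
  where
  contract : ∀ N → app active (lam active (app active (wkᴿ M) (var 0))) N ⇛ app active M N
  contract N = ⇛-beta _ N (cong (λ X → app active X N) (wkᴿ-[] M))

-- Reducibility to a variable is invariant under conversion.

strip : ∀ {A : Set} {R S : Rel A 0ℓ} →
  (∀ {x y z} → R x y → S x z → ∃[ w ] S y w × R z w) →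
  ∀ {x y z} → R x y → Star S x z → ∃[ w ] Star S y w × R z w
strip d r ε = _ , ε , r
strip d r (s ◅ ss) with d r s
... | _ , s′ , r′ with strip d r′ ss
... | _ , ss′ , r″ = _ , s′ ◅ ss′ , r″

η-postponement* : ∀ {M N P} → M ⊒ N → N ⇛* P → ∃[ Q ] M ⇛* Q × Q ⊒ P
η-postponement* r ε = _ , ε , r
η-postponement* r (q ◅ qs) with η-postponement r q
... | _ , qs₁ , r′ with η-postponement* r′ qs
... | _ , qs₂ , r″ = _ , qs₁ ◅◅ qs₂ , r″

-- β precedes η because typing is carried along β-steps first and along a whole η-normalisation
-- afterwards. As the predicate is closed under steps in both directions, it passes through a
-- conversion without a separate Church-Rosser theorem for the mixed relation.
_⇓var_ : Raw → ℕ → Set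
M ⇓var k = ∃[ N ] M ⇛* N × N ⊒* var k

data _⟿_ (M N : Raw) : Set where
  β : M ⇛ N → M ⟿ N
  η : M ⊒ N → M ⟿ N

⇓var-reduct : ∀ {M N k} → M ⟿ N → M ⇓var k → N ⇓var k
⇓var-reduct (β r) (_ , rs , es) with strip ⇛-diamond r rs
... | _ , rs′ , r′ with strip (λ p q → map₂ swap (η-commutes-β q p)) r′ es
-- The closing edge of the diagram starts at a variable, so it is trivial and the η-sequence ends at
-- that variable.
... | _ , es′ , var = _ , rs′ , es′
⇓var-reduct (η e) (_ , rs , es) with strip η-commutes-β e rs
... | _ , rs′ , e′ with strip ⊒-diamond e′ es
... | _ , es′ , var = _ , rs′ , es′

⇓var-expand : ∀ {M N k} → M ⟿ N → N ⇓var k → M ⇓var k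
⇓var-expand (β r) (_ , rs , es) = _ , r ◅ rs , es
⇓var-expand (η e) (_ , rs , es) with η-postponement* e rs
... | _ , rs′ , e′ = _ , rs′ , e′ ◅ es

-- Raw images of types and terms

⌜_⌝ : Ty → Raw
⌜ tvar a ⌝ = var a
⌜ σ ⇒ τ ⌝  = app rigid ⌜ σ ⌝ ⌜ τ ⌝
⌜ ∀̇ σ ⌝    = lam rigid ⌜ σ ⌝

-- Lets the renaming and substitution identities of types be read off from those of raw terms
-- instead of being proved by a second induction.
⌜⌝-injective : ∀ σ τ → ⌜ σ ⌝ ≡ ⌜ τ ⌝ → σ ≡ τ
⌜⌝-injective (tvar a) (tvar b) e = cong tvar (var-injective e)
⌜⌝-injective (σ ⇒ σ′) (τ ⇒ τ′) e with app-injective e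
... | _ , e₁ , e₂ = cong₂ _⇒_ (⌜⌝-injective σ τ e₁) (⌜⌝-injective σ′ τ′ e₂)
⌜⌝-injective (∀̇ σ) (∀̇ τ) e = cong ∀̇ (⌜⌝-injective σ τ (proj₂ (lam-injective e)))

⌜⌝-ren : ∀ ξ σ → ⌜ renᵀ ξ σ ⌝ ≡ renᴿ ξ ⌜ σ ⌝
⌜⌝-ren ξ (tvar a) = refl
⌜⌝-ren ξ (σ ⇒ τ)  = cong₂ (app rigid) (⌜⌝-ren ξ σ) (⌜⌝-ren ξ τ)
⌜⌝-ren ξ (∀̇ σ)    = cong (lam rigid) (⌜⌝-ren (liftᵀʳ ξ) σ)

⌜⌝-sub : ∀ {s u} → (∀ a → ⌜ s a ⌝ ≡ u a) → ∀ σ → ⌜ subᵀ s σ ⌝ ≡ subᴿ u ⌜ σ ⌝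
⌜⌝-sub h (tvar a) = h a
⌜⌝-sub h (σ ⇒ τ)  = cong₂ (app rigid) (⌜⌝-sub h σ) (⌜⌝-sub h τ)
⌜⌝-sub {s} h (∀̇ σ) = cong (lam rigid)
  (⌜⌝-sub (λ { zero → refl ; (suc a) → trans (⌜⌝-ren suc (s a)) (cong wkᴿ (h a)) }) σ)

⌜⌝-[] : ∀ σ τ → ⌜ σ [ τ ]ᵀ ⌝ ≡ ⌜ σ ⌝ [ ⌜ τ ⌝ ]ᴿ
⌜⌝-[] σ τ = ⌜⌝-sub (λ { zero → refl ; (suc _) → refl }) σ

⌜⌝-ren⁻¹ : ∀ ξ σ M → ⌜ σ ⌝ ≡ renᴿ ξ M → ∃[ σ′ ] M ≡ ⌜ σ′ ⌝ × σ ≡ renᵀ ξ σ′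
⌜⌝-ren⁻¹ ξ (tvar a) (var b) e = tvar b , refl , cong tvar (var-injective e)
⌜⌝-ren⁻¹ ξ (σ ⇒ τ) (app t M N) e with app-injective e
... | refl , e₁ , e₂ with ⌜⌝-ren⁻¹ ξ σ M e₁ | ⌜⌝-ren⁻¹ ξ τ N e₂
... | σ′ , d₁ , d₁′ | τ′ , d₂ , d₂′ = σ′ ⇒ τ′ , cong₂ (app rigid) d₁ d₂ , cong₂ _⇒_ d₁′ d₂′
⌜⌝-ren⁻¹ ξ (∀̇ σ) (lam t M) e with lam-injective e
... | refl , e′ with ⌜⌝-ren⁻¹ (liftᵀʳ ξ) σ M e′
... | σ′ , d , d′ = ∀̇ σ′ , cong (lam rigid) d , cong ∀̇ d′

renᵀ-id : ∀ σ → renᵀ id σ ≡ σ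
renᵀ-id σ = ⌜⌝-injective _ _ (trans (⌜⌝-ren id σ) (renᴿ-id (λ _ → refl) ⌜ σ ⌝))

subᵀ-tvar : ∀ σ → subᵀ tvar σ ≡ σ
subᵀ-tvar σ = ⌜⌝-injective _ _ (trans (⌜⌝-sub (λ _ → refl) σ) (subᴿ-id (λ _ → refl) ⌜ σ ⌝))

renᵀ-injective : ∀ {ξ} → Injective ξ → ∀ σ τ → renᵀ ξ σ ≡ renᵀ ξ τ → σ ≡ τ
renᵀ-injective {ξ} i σ τ e = ⌜⌝-injective σ τ (renᴿ-injective i ⌜ σ ⌝ ⌜ τ ⌝
  (trans (sym (⌜⌝-ren ξ σ)) (trans (cong ⌜_⌝ e) (⌜⌝-ren ξ τ))))

renᵀ-wkᵀ : ∀ ξ σ → renᵀ (liftᵀʳ ξ) (wkᵀ σ) ≡ wkᵀ (renᵀ ξ σ)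
renᵀ-wkᵀ ξ σ = ⌜⌝-injective _ _ (begin
  ⌜ renᵀ (liftᵀʳ ξ) (wkᵀ σ) ⌝     ≡⟨ ⌜⌝-ren (liftᵀʳ ξ) (wkᵀ σ) ⟩
  renᴿ (liftᵀʳ ξ) ⌜ wkᵀ σ ⌝       ≡⟨ cong (renᴿ (liftᵀʳ ξ)) (⌜⌝-ren suc σ) ⟩
  renᴿ (liftᵀʳ ξ) (wkᴿ ⌜ σ ⌝)     ≡⟨ renᴿ-wkᴿ ξ ⌜ σ ⌝ ⟩
  wkᴿ (renᴿ ξ ⌜ σ ⌝)              ≡⟨ cong wkᴿ (⌜⌝-ren ξ σ) ⟨
  wkᴿ ⌜ renᵀ ξ σ ⌝                ≡⟨ ⌜⌝-ren suc (renᵀ ξ σ) ⟨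
  ⌜ wkᵀ (renᵀ ξ σ) ⌝              ∎)

subᵀ-wkᵀ : ∀ s σ → subᵀ (liftᵀ s) (wkᵀ σ) ≡ wkᵀ (subᵀ s σ)
subᵀ-wkᵀ s σ = ⌜⌝-injective _ _ (begin
  ⌜ subᵀ (liftᵀ s) (wkᵀ σ) ⌝      ≡⟨ ⌜⌝-sub (λ _ → refl) (wkᵀ σ) ⟩
  subᴿ (⌜_⌝ ∘ liftᵀ s) ⌜ wkᵀ σ ⌝  ≡⟨ cong (subᴿ (⌜_⌝ ∘ liftᵀ s)) (⌜⌝-ren suc σ) ⟩
  subᴿ (⌜_⌝ ∘ liftᵀ s) (wkᴿ ⌜ σ ⌝) ≡⟨ subᴿ-renᴿ (λ a → ⌜⌝-ren suc (s a)) ⌜ σ ⌝ ⟩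
  subᴿ (wkᴿ ∘ ⌜_⌝ ∘ s) ⌜ σ ⌝      ≡⟨ renᴿ-subᴿ (λ _ → refl) ⌜ σ ⌝ ⟨
  wkᴿ (subᴿ (⌜_⌝ ∘ s) ⌜ σ ⌝)      ≡⟨ cong wkᴿ (⌜⌝-sub (λ _ → refl) σ) ⟨
  wkᴿ ⌜ subᵀ s σ ⌝                ≡⟨ ⌜⌝-ren suc (subᵀ s σ) ⟨
  ⌜ wkᵀ (subᵀ s σ) ⌝              ∎)

wkᵀ-[] : ∀ σ {τ} → wkᵀ σ [ τ ]ᵀ ≡ σ
wkᵀ-[] σ {τ} = ⌜⌝-injective _ _ (begin
  ⌜ wkᵀ σ [ τ ]ᵀ ⌝        ≡⟨ ⌜⌝-[] (wkᵀ σ) τ ⟩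
  ⌜ wkᵀ σ ⌝ [ ⌜ τ ⌝ ]ᴿ    ≡⟨ cong _[ ⌜ τ ⌝ ]ᴿ (⌜⌝-ren suc σ) ⟩
  wkᴿ ⌜ σ ⌝ [ ⌜ τ ⌝ ]ᴿ    ≡⟨ wkᴿ-[] ⌜ σ ⌝ ⟩
  ⌜ σ ⌝                   ∎)

renᵀ-[] : ∀ ξ σ τ → renᵀ ξ (σ [ τ ]ᵀ) ≡ renᵀ (liftᵀʳ ξ) σ [ renᵀ ξ τ ]ᵀ
renᵀ-[] ξ σ τ = ⌜⌝-injective _ _ (begin
  ⌜ renᵀ ξ (σ [ τ ]ᵀ) ⌝                       ≡⟨ ⌜⌝-ren ξ (σ [ τ ]ᵀ) ⟩
  renᴿ ξ ⌜ σ [ τ ]ᵀ ⌝                         ≡⟨ cong (renᴿ ξ) (⌜⌝-[] σ τ) ⟩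
  renᴿ ξ (⌜ σ ⌝ [ ⌜ τ ⌝ ]ᴿ)                   ≡⟨ renᴿ-[] ξ ⌜ σ ⌝ ⌜ τ ⌝ ⟩
  renᴿ (liftᵀʳ ξ) ⌜ σ ⌝ [ renᴿ ξ ⌜ τ ⌝ ]ᴿ     ≡⟨ cong₂ _[_]ᴿ (⌜⌝-ren (liftᵀʳ ξ) σ) (⌜⌝-ren ξ τ) ⟨
  ⌜ renᵀ (liftᵀʳ ξ) σ ⌝ [ ⌜ renᵀ ξ τ ⌝ ]ᴿ     ≡⟨ ⌜⌝-[] (renᵀ (liftᵀʳ ξ) σ) (renᵀ ξ τ) ⟨
  ⌜ renᵀ (liftᵀʳ ξ) σ [ renᵀ ξ τ ]ᵀ ⌝         ∎)

subᵀ-[] : ∀ s σ τ → subᵀ s (σ [ τ ]ᵀ) ≡ subᵀ (liftᵀ s) σ [ subᵀ s τ ]ᵀ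
subᵀ-[] s σ τ = ⌜⌝-injective _ _ (begin
  ⌜ subᵀ s (σ [ τ ]ᵀ) ⌝                       ≡⟨ ⌜⌝-sub (λ _ → refl) (σ [ τ ]ᵀ) ⟩
  subᴿ s′ ⌜ σ [ τ ]ᵀ ⌝                        ≡⟨ cong (subᴿ s′) (⌜⌝-[] σ τ) ⟩
  subᴿ s′ (⌜ σ ⌝ [ ⌜ τ ⌝ ]ᴿ)                  ≡⟨ subᴿ-[] s′ ⌜ σ ⌝ ⌜ τ ⌝ ⟩
  subᴿ (liftᴿ s′) ⌜ σ ⌝ [ subᴿ s′ ⌜ τ ⌝ ]ᴿ    ≡⟨ cong₂ _[_]ᴿ (⌜⌝-sub lifts σ) (⌜⌝-sub (λ _ → refl) τ) ⟨
  ⌜ subᵀ (liftᵀ s) σ ⌝ [ ⌜ subᵀ s τ ⌝ ]ᴿ      ≡⟨ ⌜⌝-[] (subᵀ (liftᵀ s) σ) (subᵀ s τ) ⟨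
  ⌜ subᵀ (liftᵀ s) σ [ subᵀ s τ ]ᵀ ⌝          ∎)
  where
  s′ = ⌜_⌝ ∘ s
  lifts : ∀ a → ⌜ liftᵀ s a ⌝ ≡ liftᴿ s′ a
  lifts zero    = refl
  lifts (suc a) = ⌜⌝-ren suc (s a)

liftᶠ : ∀ {n} → (Fin n → Raw) → Fin (suc n) → Raw
liftᶠ g zero    = var zero
liftᶠ g (suc i) = wkᴿ (g i)

-- Annotations are erased because with them βη-reduction of untypable terms is
-- not confluent. Both kinds of abstraction are identified because otherwise
-- η-postponement fails on untypable terms such as Λ (ƛ σ M ∙ tvar 0) · N.
⟦_⟧ : ∀ {n} → Tm n → (ℕ → Raw) → (Fin n → Raw) → Raw
⟦ var i ⟧ f g = g i
⟦ ƛ σ M ⟧ f g = lam active (⟦ M ⟧ (wkᴿ ∘ f) (liftᶠ g))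
⟦ M · N ⟧ f g = app active (⟦ M ⟧ f g) (⟦ N ⟧ f g)
⟦ Λ M ⟧ f g   = lam active (⟦ M ⟧ (liftᴿ f) (wkᴿ ∘ g))
⟦ M ∙ σ ⟧ f g = app active (⟦ M ⟧ f g) (subᴿ f ⌜ σ ⌝)

liftᶠ-cong : ∀ {n} {g h : Fin n → Raw} → (∀ i → g i ≡ h i) → ∀ i → liftᶠ g i ≡ liftᶠ h i
liftᶠ-cong h zero    = refl
liftᶠ-cong h (suc i) = cong wkᴿ (h i)

⟦⟧-subᴿ : ∀ {n} {s f f′} {g g′ : Fin n → Raw} →
  (∀ a → subᴿ s (f a) ≡ f′ a) → (∀ i → subᴿ s (g i) ≡ g′ i) →
  ∀ M → subᴿ s (⟦ M ⟧ f g) ≡ ⟦ M ⟧ f′ g′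
⟦⟧-subᴿ p q (var i) = q i
⟦⟧-subᴿ {s = s} {f} {g = g} p q (ƛ σ M) = cong (lam active) (⟦⟧-subᴿ
  (λ a → trans (subᴿ-wkᴿ s (f a)) (cong wkᴿ (p a)))
  (λ { zero → refl ; (suc i) → trans (subᴿ-wkᴿ s (g i)) (cong wkᴿ (q i)) }) M)
⟦⟧-subᴿ p q (M · N) = cong₂ (app active) (⟦⟧-subᴿ p q M) (⟦⟧-subᴿ p q N)
⟦⟧-subᴿ {s = s} {f} {g = g} p q (Λ M) = cong (lam active) (⟦⟧-subᴿ
  (λ { zero → refl ; (suc a) → trans (subᴿ-wkᴿ s (f a)) (cong wkᴿ (p a)) })
  (λ i → trans (subᴿ-wkᴿ s (g i)) (cong wkᴿ (q i))) M)
⟦⟧-subᴿ p q (M ∙ σ) = cong₂ (app active) (⟦⟧-subᴿ p q M) (subᴿ-subᴿ p ⌜ σ ⌝)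

⟦⟧-wkᴿ : ∀ {n} f (g : Fin n → Raw) M → wkᴿ (⟦ M ⟧ f g) ≡ ⟦ M ⟧ (wkᴿ ∘ f) (wkᴿ ∘ g)
⟦⟧-wkᴿ f g M = trans (sym (subᴿ-var (λ _ → refl) (⟦ M ⟧ f g)))
  (⟦⟧-subᴿ (λ a → subᴿ-var (λ _ → refl) (f a)) (λ i → subᴿ-var (λ _ → refl) (g i)) M)

⟦⟧-renᵗ : ∀ {n ξ f f′} {g g′ : Fin n → Raw} → (∀ a → f (ξ a) ≡ f′ a) → (∀ i → g i ≡ g′ i) →
  ∀ M → ⟦ renᵗ ξ M ⟧ f g ≡ ⟦ M ⟧ f′ g′
⟦⟧-renᵗ p q (var i) = q i
⟦⟧-renᵗ p q (ƛ σ M) = cong (lam active) (⟦⟧-renᵗ (λ a → cong wkᴿ (p a)) (liftᶠ-cong q) M)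
⟦⟧-renᵗ p q (M · N) = cong₂ (app active) (⟦⟧-renᵗ p q M) (⟦⟧-renᵗ p q N)
⟦⟧-renᵗ p q (Λ M)   = cong (lam active)
  (⟦⟧-renᵗ (λ { zero → refl ; (suc a) → cong wkᴿ (p a) }) (λ i → cong wkᴿ (q i)) M)
⟦⟧-renᵗ {ξ = ξ} {f} p q (M ∙ σ) = cong₂ (app active) (⟦⟧-renᵗ p q M)
  (trans (cong (subᴿ f) (⌜⌝-ren ξ σ)) (subᴿ-renᴿ p ⌜ σ ⌝))

⟦⟧-subᵗ : ∀ {n s f f′} {g g′ : Fin n → Raw} →
  (∀ a → subᴿ f ⌜ s a ⌝ ≡ f′ a) → (∀ i → g i ≡ g′ i) → ∀ M → ⟦ subᵗ s M ⟧ f g ≡ ⟦ M ⟧ f′ g′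
⟦⟧-subᵗ p q (var i) = q i
⟦⟧-subᵗ {s = s} p q (ƛ σ M) = cong (lam active) (⟦⟧-subᵗ
  (λ a → trans (sym (renᴿ-subᴿ (λ _ → refl) ⌜ s a ⌝)) (cong wkᴿ (p a))) (liftᶠ-cong q) M)
⟦⟧-subᵗ p q (M · N) = cong₂ (app active) (⟦⟧-subᵗ p q M) (⟦⟧-subᵗ p q N)
⟦⟧-subᵗ {s = s} {f} {f′} p q (Λ M) =
  cong (lam active) (⟦⟧-subᵗ p′ (λ i → cong wkᴿ (q i)) M)
  where
  p′ : ∀ a → subᴿ (liftᴿ f) ⌜ liftᵀ s a ⌝ ≡ liftᴿ f′ a
  p′ zero    = refl
  p′ (suc a) = trans (cong (subᴿ (liftᴿ f)) (⌜⌝-ren suc (s a)))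
    (trans (subᴿ-wkᴿ f ⌜ s a ⌝) (cong wkᴿ (p a)))
⟦⟧-subᵗ {f = f} p q (M ∙ σ) = cong₂ (app active) (⟦⟧-subᵗ p q M)
  (trans (cong (subᴿ f) (⌜⌝-sub (λ _ → refl) σ)) (subᴿ-subᴿ p ⌜ σ ⌝))

⟦⟧-ren : ∀ {m n f} {κ : Fin m → Fin n} {g g′} → (∀ i → g (κ i) ≡ g′ i) →
  ∀ M → ⟦ ren κ M ⟧ f g ≡ ⟦ M ⟧ f g′
⟦⟧-ren q (var i) = q i
⟦⟧-ren q (ƛ σ M) = cong (lam active) (⟦⟧-ren (λ { zero → refl ; (suc i) → cong wkᴿ (q i) }) M)
⟦⟧-ren q (M · N) = cong₂ (app active) (⟦⟧-ren q M) (⟦⟧-ren q N)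
⟦⟧-ren q (Λ M)   = cong (lam active) (⟦⟧-ren (λ i → cong wkᴿ (q i)) M)
⟦⟧-ren {f = f} q (M ∙ σ) = cong (λ X → app active X (subᴿ f ⌜ σ ⌝)) (⟦⟧-ren q M)

⟦⟧-sub : ∀ {m n f} {s : Fin m → Tm n} {g g′} → (∀ i → ⟦ s i ⟧ f g ≡ g′ i) →
  ∀ M → ⟦ sub s M ⟧ f g ≡ ⟦ M ⟧ f g′
⟦⟧-sub q (var i) = q i
⟦⟧-sub {f = f} {s} {g} q (ƛ σ M) = cong (lam active) (⟦⟧-sub (λ
  { zero    → refl
  ; (suc i) → trans (⟦⟧-ren (λ _ → refl) (s i))
                (trans (sym (⟦⟧-wkᴿ f g (s i))) (cong wkᴿ (q i))) }) M)
⟦⟧-sub q (M · N) = cong₂ (app active) (⟦⟧-sub q M) (⟦⟧-sub q N)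
⟦⟧-sub {f = f} {s} {g} q (Λ M) = cong (lam active) (⟦⟧-sub
  (λ i → trans (⟦⟧-renᵗ (λ _ → refl) (λ _ → refl) (s i))
           (trans (sym (⟦⟧-wkᴿ f g (s i))) (cong wkᴿ (q i)))) M)
⟦⟧-sub {f = f} q (M ∙ σ) = cong (λ X → app active X (subᴿ f ⌜ σ ⌝)) (⟦⟧-sub q M)

-- Reduction and conversion of raw images.

⟿-lam : ∀ {M N} → M ⟿ N → lam active M ⟿ lam active N
⟿-lam (β r) = β (lam r)
⟿-lam (η r) = η (lam r)

⟿-appˡ : ∀ {M M′ N} → M ⟿ M′ → app active M N ⟿ app active M′ N
⟿-appˡ {N = N} (β r) = β (app r (⇛-refl N))
⟿-appˡ {N = N} (η r) = η (app r (⊒-refl N))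

⟿-appʳ : ∀ {M N N′} → N ⟿ N′ → app active M N ⟿ app active M N′
⟿-appʳ {M} (β r) = β (app (⇛-refl M) r)
⟿-appʳ {M} (η r) = η (app (⊒-refl M) r)

⟦⟧-[] : ∀ {n} f (g : Fin n → Raw) M N →
  ⟦ M ⟧ (wkᴿ ∘ f) (liftᶠ g) [ ⟦ N ⟧ f g ]ᴿ ≡ ⟦ M [ N ] ⟧ f g
⟦⟧-[] f g M N = trans
  (⟦⟧-subᴿ {g′ = g′} (λ a → wkᴿ-[] (f a)) (λ { zero → refl ; (suc i) → wkᴿ-[] (g i) }) M)
  (sym (⟦⟧-sub (λ { zero → refl ; (suc _) → refl }) M))
  where
  g′ : Fin _ → Raw
  g′ zero    = ⟦ N ⟧ f g
  g′ (suc i) = g i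

⟦⟧-[]ᵗ : ∀ {n} f (g : Fin n → Raw) M τ →
  ⟦ M ⟧ (liftᴿ f) (wkᴿ ∘ g) [ subᴿ f ⌜ τ ⌝ ]ᴿ ≡ ⟦ M [ τ ]ᵗ ⟧ f g
⟦⟧-[]ᵗ f g M τ = trans
  (⟦⟧-subᴿ {f′ = f′} (λ { zero → refl ; (suc a) → wkᴿ-[] (f a) }) (λ i → wkᴿ-[] (g i)) M)
  (sym (⟦⟧-subᵗ (λ { zero → refl ; (suc _) → refl }) (λ _ → refl) M))
  where
  f′ : ℕ → Raw
  f′ zero    = subᴿ f ⌜ τ ⌝
  f′ (suc a) = f a

⟦⟧-⟶ : ∀ {n f} {g : Fin n → Raw} {M N} → M ⟶ N → ⟦ M ⟧ f g ⟿ ⟦ N ⟧ f g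
⟦⟧-⟶ {f = f} {g} (β-ƛ {M = M} {N}) = β (⇛-beta _ _ (⟦⟧-[] f g M N))
⟦⟧-⟶ {f = f} {g} (β-Λ {M} {τ})     = β (⇛-beta _ _ (⟦⟧-[]ᵗ f g M τ))
⟦⟧-⟶ {f = f} {g} (η-ƛ {M = M}) =
  η (eta (trans (⟦⟧-ren (λ _ → refl) M) (sym (⟦⟧-wkᴿ f g M))) (⊒-refl (⟦ M ⟧ f g)))
⟦⟧-⟶ {f = f} {g} (η-Λ {M}) =
  η (eta (trans (⟦⟧-renᵗ (λ _ → refl) (λ _ → refl) M) (sym (⟦⟧-wkᴿ f g M))) (⊒-refl (⟦ M ⟧ f g)))
⟦⟧-⟶ (ξ-ƛ r)  = ⟿-lam (⟦⟧-⟶ r)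
⟦⟧-⟶ (ξ-·ˡ r) = ⟿-appˡ (⟦⟧-⟶ r)
⟦⟧-⟶ (ξ-·ʳ r) = ⟿-appʳ (⟦⟧-⟶ r)
⟦⟧-⟶ (ξ-Λ r)  = ⟿-lam (⟦⟧-⟶ r)
⟦⟧-⟶ (ξ-∙ r)  = ⟿-appˡ (⟦⟧-⟶ r)

=βη⇒⇓var : ∀ {n f} {g : Fin n → Raw} {M N k} →
  M =βη N → ⟦ N ⟧ f g ⇓var k → ⟦ M ⟧ f g ⇓var k
=βη⇒⇓var ε c = c
=βη⇒⇓var (fwd r ◅ rs) c = ⇓var-expand (⟦⟧-⟶ r) (=βη⇒⇓var rs c)
=βη⇒⇓var (bwd r ◅ rs) c = ⇓var-reduct (⟦⟧-⟶ r) (=βη⇒⇓var rs c)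

-- Typing of raw terms

-- A context is a relation: one raw variable may have several types.
Ctx : Set₁
Ctx = ℕ → Ty → Set

_▸_ : Ctx → Ty → Ctx
(Γ ▸ σ) zero    τ = τ ≡ σ
(Γ ▸ σ) (suc k) τ = Γ k τ

-- The new name stands for a type variable, so as a term it has no type at all.
_▸ᵀ : Ctx → Ctx
(Γ ▸ᵀ) zero    τ = ⊥
(Γ ▸ᵀ) (suc k) τ = ∃[ σ ] Γ k σ × τ ≡ wkᵀ σ

infix 4 _⨾_⊩_∶_

-- Type variable a is represented by the raw variable f a; f need not be injective.
data _⨾_⊩_∶_ (f : ℕ → ℕ) (Γ : Ctx) : Raw → Ty → Set where
  ⊩var : ∀ {k σ} → Γ k σ → f ⨾ Γ ⊩ var k ∶ σ
  ⊩ƛ   : ∀ {M σ τ} → suc ∘ f ⨾ Γ ▸ σ ⊩ M ∶ τ → f ⨾ Γ ⊩ lam active M ∶ σ ⇒ τ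
  ⊩·   : ∀ {M N σ τ} → f ⨾ Γ ⊩ M ∶ σ ⇒ τ → f ⨾ Γ ⊩ N ∶ σ → f ⨾ Γ ⊩ app active M N ∶ τ
  ⊩Λ   : ∀ {M σ} → liftᵀʳ f ⨾ Γ ▸ᵀ ⊩ M ∶ σ → f ⨾ Γ ⊩ lam active M ∶ ∀̇ σ
  ⊩∙   : ∀ {M N σ σ′} → f ⨾ Γ ⊩ M ∶ ∀̇ σ → ∀ τ → N ≡ renᴿ f ⌜ τ ⌝ → σ′ ≡ σ [ τ ]ᵀ →
         f ⨾ Γ ⊩ app active M N ∶ σ′

-- The relabelling `θ` changes only the types: annotations are erased, and on type arguments `f`
-- after `θ` yields the names given by `f₀`. One raw term can thus be typed at differently
-- relabelled types.
⊩-embed : ∀ {n f₀ f θ} {g : Fin n → Raw} {Γ E M σ} → (∀ a → f₀ a ≡ var (f (θ a))) →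
  (∀ i → ∃[ k ] g i ≡ var k × Γ k (renᵀ θ (lookup E i))) →
  E ⊢ M ∶ σ → f ⨾ Γ ⊩ ⟦ M ⟧ f₀ g ∶ renᵀ θ σ
⊩-embed p q (⊢var i) with q i
... | k , e , γ = subst (_ ⨾ _ ⊩_∶ _) (sym e) (⊩var γ)
⊩-embed {θ = θ} {g} {Γ} {E} p q (⊢ƛ {σ} d) = ⊩ƛ (⊩-embed (λ a → cong wkᴿ (p a)) q′ d)
  where
  q′ : ∀ i → ∃[ k ] liftᶠ g i ≡ var k × (Γ ▸ renᵀ θ σ) k (renᵀ θ (lookup (σ ∷ E) i))
  q′ zero = zero , refl , refl
  q′ (suc i) with q i
  ... | k , e , γ = suc k , cong wkᴿ e , γ
⊩-embed p q (⊢· d e) = ⊩· (⊩-embed p q d) (⊩-embed p q e)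
⊩-embed {f₀ = f₀} {f} {θ} {g} {Γ} {E} p q (⊢Λ d) = ⊩Λ (⊩-embed p′ q′ d)
  where
  p′ : ∀ a → liftᴿ f₀ a ≡ var (liftᵀʳ f (liftᵀʳ θ a))
  p′ zero    = refl
  p′ (suc a) = cong wkᴿ (p a)
  q′ : ∀ i → ∃[ k ] wkᴿ (g i) ≡ var k × (Γ ▸ᵀ) k (renᵀ (liftᵀʳ θ) (lookup (map wkᵀ E) i))
  q′ i with q i
  ... | k , e , γ = suc k , cong wkᴿ e , _ , γ ,
    trans (cong (renᵀ (liftᵀʳ θ)) (lookup-map i wkᵀ E)) (renᵀ-wkᵀ θ (lookup E i))
⊩-embed {f = f} {θ} p q (⊢∙ {σ} d τ) = ⊩∙ (⊩-embed p q d) (renᵀ θ τ)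
  (trans (subᴿ-var p ⌜ τ ⌝)
    (trans (sym (renᴿ-renᴿ (λ _ → refl) ⌜ τ ⌝)) (cong (renᴿ f) (sym (⌜⌝-ren θ τ)))))
  (renᵀ-[] θ σ τ)

⊩-ren : ∀ {f f′ ξ θ Γ Γ′ M σ} → (∀ a → ξ (f a) ≡ f′ (θ a)) →
  (∀ k {σ} → Γ k σ → Γ′ (ξ k) (renᵀ θ σ)) →
  f ⨾ Γ ⊩ M ∶ σ → f′ ⨾ Γ′ ⊩ renᴿ ξ M ∶ renᵀ θ σ
⊩-ren p q (⊩var {k} γ) = ⊩var (q k γ)
⊩-ren {θ = θ} p q (⊩ƛ d) = ⊩ƛ (⊩-ren (λ a → cong suc (p a))
  (λ { zero e → cong (renᵀ θ) e ; (suc k) γ → q k γ }) d)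
⊩-ren p q (⊩· d e) = ⊩· (⊩-ren p q d) (⊩-ren p q e)
⊩-ren {θ = θ} p q (⊩Λ d) = ⊩Λ (⊩-ren (λ { zero → refl ; (suc a) → cong suc (p a) })
  (λ { (suc k) (σ , γ , refl) → renᵀ θ σ , q k γ , renᵀ-wkᵀ θ σ }) d)
⊩-ren {f′ = f′} {θ = θ} p q (⊩∙ {σ = σ} d τ refl refl) = ⊩∙ (⊩-ren p q d) (renᵀ θ τ)
  (trans (renᴿ-renᴿ p ⌜ τ ⌝)
    (trans (sym (renᴿ-renᴿ (λ _ → refl) ⌜ τ ⌝)) (cong (renᴿ f′) (sym (⌜⌝-ren θ τ)))))
  (renᵀ-[] θ σ τ)

-- Raw term and type are substituted in parallel, so that one lemma serves both β-rules: `θ` is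
-- `tvar` for a term argument and `singleᵀ τ` for a type argument.
⊩-sub : ∀ {f f′ s θ Γ Γ′ M σ} → (∀ a → s (f a) ≡ renᴿ f′ ⌜ θ a ⌝) →
  (∀ k {σ} → Γ k σ → f′ ⨾ Γ′ ⊩ s k ∶ subᵀ θ σ) →
  f ⨾ Γ ⊩ M ∶ σ → f′ ⨾ Γ′ ⊩ subᴿ s M ∶ subᵀ θ σ
⊩-sub p q (⊩var {k} γ) = q k γ
⊩-sub {f′ = f′} {s} {θ} {Γ} {Γ′} p q (⊩ƛ {σ = σ} d) = ⊩ƛ (⊩-sub
  (λ a → trans (cong wkᴿ (p a)) (renᴿ-renᴿ (λ _ → refl) ⌜ θ a ⌝)) q′ d)
  where
  q′ : ∀ k {τ} → (Γ ▸ σ) k τ → suc ∘ f′ ⨾ Γ′ ▸ subᵀ θ σ ⊩ liftᴿ s k ∶ subᵀ θ τ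
  q′ zero refl = ⊩var refl
  q′ (suc k) {τ} γ = subst (_ ⨾ _ ⊩ _ ∶_) (renᵀ-id (subᵀ θ τ))
    (⊩-ren (λ _ → refl) (λ l {σ} → subst (Γ′ l) (sym (renᵀ-id σ))) (q k γ))
⊩-sub p q (⊩· d e) = ⊩· (⊩-sub p q d) (⊩-sub p q e)
⊩-sub {f} {f′} {s} {θ} {Γ} {Γ′} p q (⊩Λ d) = ⊩Λ (⊩-sub p′ q′ d)
  where
  p′ : ∀ a → liftᴿ s (liftᵀʳ f a) ≡ renᴿ (liftᵀʳ f′) ⌜ liftᵀ θ a ⌝
  p′ zero    = refl
  p′ (suc a) = trans (cong wkᴿ (p a)) (trans (sym (renᴿ-wkᴿ f′ ⌜ θ a ⌝))
    (cong (renᴿ (liftᵀʳ f′)) (sym (⌜⌝-ren suc (θ a)))))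
  q′ : ∀ k {τ} → (Γ ▸ᵀ) k τ → liftᵀʳ f′ ⨾ Γ′ ▸ᵀ ⊩ liftᴿ s k ∶ subᵀ (liftᵀ θ) τ
  q′ (suc k) (σ , γ , refl) = subst (_ ⨾ _ ⊩ _ ∶_) (sym (subᵀ-wkᵀ θ σ))
    (⊩-ren (λ _ → refl) (λ _ γ′ → _ , γ′ , refl) (q k γ))
⊩-sub {f′ = f′} {s} {θ} p q (⊩∙ {σ = σ} d τ refl refl) = ⊩∙ (⊩-sub p q d) (subᵀ θ τ)
  (trans (subᴿ-renᴿ p ⌜ τ ⌝)
    (trans (sym (renᴿ-subᴿ (λ _ → refl) ⌜ τ ⌝)) (cong (renᴿ f′) (sym (⌜⌝-sub (λ _ → refl) τ)))))
  (subᵀ-[] θ σ τ)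

⊩-[] : ∀ {f Γ M N σ τ} → suc ∘ f ⨾ Γ ▸ σ ⊩ M ∶ τ → f ⨾ Γ ⊩ N ∶ σ → f ⨾ Γ ⊩ M [ N ]ᴿ ∶ τ
⊩-[] {f} {Γ} {N = N} {σ} {τ} d e = subst (f ⨾ Γ ⊩ _ ∶_) (subᵀ-tvar τ) (⊩-sub (λ _ → refl) q d)
  where
  q : ∀ k {σ′} → (Γ ▸ σ) k σ′ → f ⨾ Γ ⊩ singleᴿ N k ∶ subᵀ tvar σ′
  q zero refl     = subst (f ⨾ Γ ⊩ N ∶_) (sym (subᵀ-tvar σ)) e
  q (suc k) {σ′} γ = ⊩var (subst (Γ k) (sym (subᵀ-tvar σ′)) γ)

⊩-[]ᵀ : ∀ {f Γ M σ} τ → liftᵀʳ f ⨾ Γ ▸ᵀ ⊩ M ∶ σ →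
  f ⨾ Γ ⊩ M [ renᴿ f ⌜ τ ⌝ ]ᴿ ∶ σ [ τ ]ᵀ
⊩-[]ᵀ {f} {Γ} τ = ⊩-sub (λ { zero → refl ; (suc _) → refl }) q
  where
  q : ∀ k {σ} → (Γ ▸ᵀ) k σ → f ⨾ Γ ⊩ singleᴿ (renᴿ f ⌜ τ ⌝) k ∶ σ [ τ ]ᵀ
  q (suc k) (σ , γ , refl) = ⊩var (subst (Γ k) (sym (wkᵀ-[] σ)) γ)

-- Subject reduction.

⌜⌝-⇛ : ∀ {f K N} τ → K ≡ renᴿ f ⌜ τ ⌝ → K ⇛ N → N ≡ renᴿ f ⌜ τ ⌝
⌜⌝-⇛ (tvar a) refl var = refl
⌜⌝-⇛ (σ ⇒ τ) refl (app r q) = cong₂ (app rigid) (⌜⌝-⇛ σ refl r) (⌜⌝-⇛ τ refl q)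
⌜⌝-⇛ (∀̇ τ) refl (lam r) = cong (lam rigid) (⌜⌝-⇛ τ refl r)

-- A typed redex cannot mix the two kinds of abstraction and application, since arrow and universal
-- types differ. When `f` identifies names, the raw argument does not determine the type argument;
-- the `τ` recorded in `⊩∙` is the one substituted.
⊩-⇛ : ∀ {f Γ M N σ} → f ⨾ Γ ⊩ M ∶ σ → M ⇛ N → f ⨾ Γ ⊩ N ∶ σ
⊩-⇛ (⊩var γ) var = ⊩var γ
⊩-⇛ (⊩ƛ d) (lam r) = ⊩ƛ (⊩-⇛ d r)
⊩-⇛ (⊩Λ d) (lam r) = ⊩Λ (⊩-⇛ d r)
⊩-⇛ (⊩· d e) (app r q) = ⊩· (⊩-⇛ d r) (⊩-⇛ e q)
⊩-⇛ (⊩· (⊩ƛ d) e) (beta r q) = ⊩-[] (⊩-⇛ d r) (⊩-⇛ e q)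
⊩-⇛ (⊩∙ d τ e e′) (app r q) = ⊩∙ (⊩-⇛ d r) τ (⌜⌝-⇛ τ e q) e′
⊩-⇛ (⊩∙ (⊩Λ d) τ e refl) (beta r q) with ⌜⌝-⇛ τ e q
... | refl = ⊩-[]ᵀ τ (⊩-⇛ d r)

⊩-⇛* : ∀ {f Γ M N σ} → f ⨾ Γ ⊩ M ∶ σ → M ⇛* N → f ⨾ Γ ⊩ N ∶ σ
⊩-⇛* d ε        = d
⊩-⇛* d (r ◅ rs) = ⊩-⇛* (⊩-⇛ d r) rs

-- Innermost η-normalisation to an abstraction-free term. A single η-step may
-- destroy typability, since an erased annotation inside the contracted body can
-- mention the abstracted type variable; without abstractions nothing is erased.
data _↓_ : Rel Raw 0ℓ where
  var : ∀ {k} → var k ↓ var k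
  app : ∀ {t M M′ N N′} → M ↓ M′ → N ↓ N′ → app t M N ↓ app t M′ N′
  eta : ∀ {M K N} → K ≡ wkᴿ N → M ↓ app active K (var 0) → lam active M ↓ N

↓-ren : ∀ ξ {M N} → M ↓ N → renᴿ ξ M ↓ renᴿ ξ N
↓-ren ξ var       = var
↓-ren ξ (app r q) = app (↓-ren ξ r) (↓-ren ξ q)
↓-ren ξ (eta {N = N} refl r) = eta (renᴿ-wkᴿ ξ N) (↓-ren (liftᵀʳ ξ) r)

-- The η-sequence is read backwards from its final variable: each η-step is absorbed into the
-- normalisation of what follows it.
⊒-↓ : ∀ {M N P} → M ⊒ N → N ↓ P → M ↓ P
⊒-↓ var q = q
⊒-↓ (lam r) (eta e q) = eta e (⊒-↓ r q)
⊒-↓ (app r₁ r₂) (app q₁ q₂) = app (⊒-↓ r₁ q₁) (⊒-↓ r₂ q₂)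
⊒-↓ (eta refl r) q = eta refl (app (↓-ren suc (⊒-↓ r q)) var)

⊒*var⇒↓ : ∀ {M k} → M ⊒* var k → M ↓ var k
⊒*var⇒↓ ε        = var
⊒*var⇒↓ (r ◅ rs) = ⊒-↓ r (⊒*var⇒↓ rs)

LamFree : Raw → Set
LamFree (var _)     = ⊤
LamFree (lam _ _)   = ⊥
LamFree (app _ M N) = LamFree M × LamFree N

LamFree-ren⁻¹ : ∀ ξ M → LamFree (renᴿ ξ M) → LamFree M
LamFree-ren⁻¹ ξ (var _)     _       = tt
LamFree-ren⁻¹ ξ (app _ M N) (p , q) = LamFree-ren⁻¹ ξ M p , LamFree-ren⁻¹ ξ N q

↓-LamFree : ∀ {M N} → M ↓ N → LamFree N
↓-LamFree var       = tt
↓-LamFree (app r q) = ↓-LamFree r , ↓-LamFree q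
↓-LamFree (eta {N = N} refl r) = LamFree-ren⁻¹ suc N (proj₁ (↓-LamFree r))

-- Without abstractions, every type in the derivation comes from the context or from a visible type
-- argument. Such an argument lies in the images of both `f` and `ξ`, so the pullback strengthens
-- it. Injectivity of `θ` makes the strengthened domain and argument types agree.
⊩-strengthen : ∀ {f f′ ξ θ Γ Γ′ K σ} → Injective θ → Pullback f ξ θ f′ →
  (∀ k {σ} → Γ (ξ k) σ → ∃[ σ′ ] σ ≡ renᵀ θ σ′ × Γ′ k σ′) →
  ∀ M → K ≡ renᴿ ξ M → LamFree M → f ⨾ Γ ⊩ K ∶ σ →
  ∃[ σ′ ] σ ≡ renᵀ θ σ′ × f′ ⨾ Γ′ ⊩ M ∶ σ′
⊩-strengthen i p q (var k) refl _ (⊩var γ) with q k γ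
... | σ′ , e , γ′ = σ′ , e , ⊩var γ′
⊩-strengthen i p q (app _ M N) refl (l , m) (⊩· d e)
  with ⊩-strengthen i p q M refl l d | ⊩-strengthen i p q N refl m e
... | σ′ ⇒ τ′ , refl , d′ | σ″ , e₁ , e′ with renᵀ-injective i σ′ σ″ e₁
... | refl = τ′ , refl , ⊩· d′ e′
⊩-strengthen {θ = θ} i p q (app _ M N) refl (l , _) (⊩∙ d τ e refl)
  with ⊩-strengthen i p q M refl l d
... | ∀̇ σ′ , refl , d′ with renᴿ-pullback p ⌜ τ ⌝ N (sym e)
... | Q , e₁ , e₂ with ⌜⌝-ren⁻¹ θ τ Q e₁
... | τ′ , refl , refl = σ′ [ τ′ ]ᵀ , sym (renᵀ-[] θ σ′ τ′) , ⊩∙ d′ τ′ e₂ refl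

wkᵀ-body-[0] : ∀ σ → renᵀ (liftᵀʳ suc) σ [ tvar 0 ]ᵀ ≡ σ
wkᵀ-body-[0] σ = ⌜⌝-injective _ _ (begin
  ⌜ renᵀ (liftᵀʳ suc) σ [ tvar 0 ]ᵀ ⌝     ≡⟨ ⌜⌝-[] (renᵀ (liftᵀʳ suc) σ) (tvar 0) ⟩
  ⌜ renᵀ (liftᵀʳ suc) σ ⌝ [ var 0 ]ᴿ      ≡⟨ cong _[ var 0 ]ᴿ (⌜⌝-ren (liftᵀʳ suc) σ) ⟩
  renᴿ (liftᵀʳ suc) ⌜ σ ⌝ [ var 0 ]ᴿ      ≡⟨ lift-suc-[0] ⌜ σ ⌝ ⟩
  ⌜ σ ⌝                                   ∎)

-- A universal type is a `rigid` abstraction, which `_↓_` does not relate to anything; hence only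
-- two cases.
⌜⌝-↓ : ∀ {f K N} τ → K ≡ renᴿ f ⌜ τ ⌝ → K ↓ N → N ≡ renᴿ f ⌜ τ ⌝
⌜⌝-↓ (tvar a) refl var = refl
⌜⌝-↓ (σ ⇒ τ) refl (app r q) = cong₂ (app rigid) (⌜⌝-↓ σ refl r) (⌜⌝-↓ τ refl q)

⊩-↓ : ∀ {f Γ M N σ} → f ⨾ Γ ⊩ M ∶ σ → M ↓ N → f ⨾ Γ ⊩ N ∶ σ
-- The name zero rules out an application of the wrong kind: below `⊩ƛ` it represents no type
-- variable, and below `⊩Λ` it has no type. Strengthening then removes the bound variable from the
-- typing of `K`.
⊩-η-ƛ : ∀ {f Γ K σ τ} N → K ≡ wkᴿ N → LamFree N →
  suc ∘ f ⨾ Γ ▸ σ ⊩ app active K (var 0) ∶ τ → f ⨾ Γ ⊩ N ∶ σ ⇒ τ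
⊩-η-Λ : ∀ {f Γ K σ} N → K ≡ wkᴿ N → LamFree N →
  liftᵀʳ f ⨾ Γ ▸ᵀ ⊩ app active K (var 0) ∶ σ → f ⨾ Γ ⊩ N ∶ ∀̇ σ

⊩-↓ (⊩var γ) var = ⊩var γ
⊩-↓ (⊩ƛ d) (eta {N = N} e r) = ⊩-η-ƛ N e (↓-LamFree (eta e r)) (⊩-↓ d r)
⊩-↓ (⊩· d e) (app r q) = ⊩· (⊩-↓ d r) (⊩-↓ e q)
⊩-↓ (⊩Λ d) (eta {N = N} e r) = ⊩-η-Λ N e (↓-LamFree (eta e r)) (⊩-↓ d r)
⊩-↓ (⊩∙ d τ e e′) (app r q) = ⊩∙ (⊩-↓ d r) τ (⌜⌝-↓ τ e q) e′

⊩-η-ƛ N e l (⊩· d (⊩var refl))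
  with ⊩-strengthen id (λ k _ e′ → k , refl , sym (suc-injective e′))
         (λ _ {σ} γ → σ , sym (renᵀ-id σ) , γ) N e l d
... | σ , e′ , d′ = subst (_ ⨾ _ ⊩ N ∶_) (sym (trans e′ (renᵀ-id σ))) d′
⊩-η-ƛ N e l (⊩∙ d (tvar _) () _)

⊩-η-Λ N e l (⊩· _ (⊩var ()))
-- Even if `f` identifies names, `liftᵀʳ f` sends only zero to zero, so the type argument is the
-- bound type variable itself.
⊩-η-Λ {f} N e l (⊩∙ d (tvar zero) _ refl)
  with ⊩-strengthen suc-injective (lift-suc-pullback f) (λ { _ (σ , γ , e′) → σ , e′ , γ }) N e l d
... | ∀̇ σ , refl , d′ = subst (λ τ → _ ⨾ _ ⊩ N ∶ ∀̇ τ) (sym (wkᵀ-body-[0] σ)) d′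

-- Free type variables, and the splitting of one of them.

FV? : ∀ σ a → Dec (FV σ a)
FV? (tvar b) a = b ≟ a
FV? (σ ⇒ τ)  a = FV? σ a ⊎-dec FV? τ a
FV? (∀̇ σ)    a = FV? σ (suc a)

renᵀ-cong-FV : ∀ {ξ ζ} σ → (∀ a → FV σ a → ξ a ≡ ζ a) → renᵀ ξ σ ≡ renᵀ ζ σ
renᵀ-cong-FV (tvar a) h = cong tvar (h a refl)
renᵀ-cong-FV (σ ⇒ τ)  h =
  cong₂ _⇒_ (renᵀ-cong-FV σ (λ a → h a ∘ inj₁)) (renᵀ-cong-FV τ (λ a → h a ∘ inj₂))
renᵀ-cong-FV (∀̇ σ)    h =
  cong ∀̇ (renᵀ-cong-FV σ (λ { zero _ → refl ; (suc a) m → cong suc (h a m) }))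

renᵀ-agree-FV : ∀ {ξ ζ} σ → renᵀ ξ σ ≡ renᵀ ζ σ → ∀ a → FV σ a → ξ a ≡ ζ a
renᵀ-agree-FV (tvar a) e .a refl = tvar-injective e
  where
  tvar-injective : ∀ {a b} → tvar a ≡ tvar b → a ≡ b
  tvar-injective refl = refl
renᵀ-agree-FV (σ ⇒ τ) e a (inj₁ m) = renᵀ-agree-FV σ (cong dom e) a m
  where
  dom : Ty → Ty
  dom (σ ⇒ _) = σ
  dom σ       = σ
renᵀ-agree-FV (σ ⇒ τ) e a (inj₂ m) = renᵀ-agree-FV τ (cong cod e) a m
  where
  cod : Ty → Ty
  cod (_ ⇒ τ) = τ
  cod τ       = τ
renᵀ-agree-FV (∀̇ σ) e a m = suc-injective (renᵀ-agree-FV σ (cong body e) (suc a) m)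
  where
  body : Ty → Ty
  body (∀̇ σ) = σ
  body σ     = σ

-- Zero is the fresh copy of `a`, and the old type variables move up by one. Thus `suc` leaves `a`
-- unrenamed, `split a` renames it, and `merge a` is a left inverse of both.
split : ℕ → ℕ → ℕ
split a b with b ≟ a
... | yes _ = zero
... | no  _ = suc b

merge : ℕ → ℕ → ℕ
merge a zero    = a
merge a (suc b) = b

merge-split : ∀ a b → b ≡ merge a (split a b)
merge-split a b with b ≟ a
... | yes e = e
... | no  _ = refl

split-self : ∀ a → split a a ≡ zero
split-self a with a ≟ a
... | yes _ = refl
... | no ¬e = ⊥-elim (¬e refl)

split-≢ : ∀ a b → b ≢ a → split a b ≡ suc b
split-≢ a b ¬e with b ≟ a
... | yes e = ⊥-elim (¬e e)
... | no  _ = refl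

retract-split : ∀ {ρ τ} a → ρ ⊴ τ → renᵀ (split a) τ ≡ renᵀ suc τ →
  renᵀ (split a) ρ ≡ renᵀ suc ρ
retract-split {ρ} {τ} a r same-τ = result (⊩-↓ (⊩-⇛* typed (proj₁ (proj₂ conv)))
                                             (⊒*var⇒↓ (proj₂ (proj₂ conv))))
  where
  open _⊴_ r

  Γ : Ctx
  Γ zero    σ = σ ≡ renᵀ suc ρ
  -- Each free variable keeps its old type for the coder and its renamed type for the decoder;
  -- identifying `y` with `y′` gives one name both types. The variable `x` has only the coder's
  -- type.
  Γ (suc k) σ = ∃[ i ] toℕ i ≡ k × (σ ≡ renᵀ suc (lookup E i) ⊎ σ ≡ renᵀ (split a) (lookup E i))

  -- A free term variable and a free type variable may share a raw name; `Γ` and `merge a` keep the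
  -- two roles apart.
  g : Fin (suc size) → Raw
  g = var ∘ toℕ

  C⊩ : merge a ⨾ Γ ⊩ ⟦ C ⟧ var g ∶ renᵀ suc τ
  C⊩ = ⊩-embed (λ _ → refl)
    (λ { zero → zero , refl , refl ; (suc i) → suc (toℕ i) , refl , i , refl , inj₁ refl }) C-typed

  D⊩ : merge a ⨾ Γ ⊩ ⟦ wk D ⟧ var g ∶ renᵀ (split a) (τ ⇒ ρ)
  D⊩ = subst (merge a ⨾ Γ ⊩_∶ renᵀ (split a) (τ ⇒ ρ)) (sym (⟦⟧-ren (λ _ → refl) D))
    (⊩-embed (λ b → cong var (merge-split a b))
      (λ i → suc (toℕ i) , refl , i , refl , inj₂ refl) D-typed)

  typed : merge a ⨾ Γ ⊩ ⟦ wk D · C ⟧ var g ∶ renᵀ (split a) ρ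
  typed = ⊩· D⊩ (subst (merge a ⨾ Γ ⊩ ⟦ C ⟧ var g ∶_) (sym same-τ) C⊩)

  conv : ⟦ wk D · C ⟧ var g ⇓var 0
  conv = =βη⇒⇓var retract (var 0 , ε , ε)

  result : merge a ⨾ Γ ⊩ var 0 ∶ renᵀ (split a) ρ → renᵀ (split a) ρ ≡ renᵀ suc ρ
  result (⊩var e) = e

proposition5p3 : (ρ τ : Ty) → ρ ⊴ τ → FV ρ ⊆ FV τ
proposition5p3 ρ τ r {a} a∈ρ with FV? τ a
... | yes a∈τ = a∈τ
-- Agreement of the two renamings on `a` would equate zero with `suc a`.
... | no  a∉τ with trans (sym (split-self a)) (renᵀ-agree-FV ρ (retract-split a r same-τ) a a∈ρ)
  where
  same-τ : renᵀ (split a) τ ≡ renᵀ suc τ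
  same-τ = renᵀ-cong-FV τ (λ b b∈τ → split-≢ a b (λ { refl → a∉τ b∈τ }))
... | ()
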